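{- For every positive integer $n$, the number of circular permutations of $[n]=\{1,2,\ldots,n\}$ that avoid the pattern $1324$ equals the Fibonacci number $F_{2n-3}$.
   Context: A circular permutation of $[n]$ is an arrangement of $1,2,\ldots,n$ clockwise around a circle, two arrangements being identified if they differ by a rotation. Equivalently, it can be represented uniquely as a linear permutation $\pi_1\pi_2\cdots\pi_n$ of $[n]$ with $\pi_n=n$, whose rotations $\pi_i\pi_{i+1}\cdots\pi_n\pi_1\cdots\pi_{i-1}$ all represent the same circular permutation. The reduced form of a sequence of distinct positive integers is obtained by replacing its smallest entry by $1$, its next smallest by $2$, and so on; a pattern is such a reduced form. An occurrence of a pattern $\tau$ of length $m$ in a circular permutation $\pi$ is a sequence of $m$ letters of $\pi$ read in clockwise order and lying within one revolution (i.e., a subsequence of some rotation of the linear representation) whose reduced form is $\tau$; $\pi$ avoids $\tau$ if it has no occurrence of $\tau$. Fibonacci numbers: $F_1=F_2=1$, $F_{m+1}=F_m+F_{m-1}$, extended to negative index by the same recurrence, so $F_{ -1}=1$. -}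

module Defs where

open import Data.Fin using (Fin)
open import Data.Integer as ℤ using (ℤ; +_; -[1+_])
open import Data.List using (List; []; _∷_; _++_; length; filter; map; upTo)
open import Data.List.Properties using (++-assoc; ++-identityʳ; ∷-injective)
open import Data.List.Relation.Binary.Permutation.Propositional using (_↭_)
open import Data.List.Relation.Binary.Sublist.Propositional using (_⊆_)
open import Data.Nat using (ℕ; zero; suc; _≤?_)
open import Data.Product using (Σ; ∃; ∃₂; _×_; _,_; proj₁)
open import Data.Sum using (_⊎_; inj₁; inj₂)
open import Function.Bundles using (Inverse)
open import Level using (Level; 0ℓ)
open import Relation.Binary.Bundles using (Setoid)
import Relation.Binary.Construct.On as On
open import Relation.Binary.PropositionalEquality
  using (_≡_; refl; sym; trans; cong; setoid)
open import Relation.Nullary using (¬_)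

private
  variable
    a ℓ : Level
    A : Set a

infix 4 _↻_

_↻_ : List A → List A → Set _
xs ↻ ys = ∃₂ λ us vs → xs ≡ us ++ vs × ys ≡ vs ++ us

↻-refl : {xs : List A} → xs ↻ xs
↻-refl {xs = xs} = [] , xs , refl , sym (++-identityʳ xs)

↻-sym : {xs ys : List A} → xs ↻ ys → ys ↻ xs
↻-sym (us , vs , p , q) = vs , us , q , p

private
  ++-overlap : (vs us ps qs : List A) → vs ++ us ≡ ps ++ qs →
    (∃ λ ms → vs ≡ ps ++ ms × qs ≡ ms ++ us) ⊎
    (∃ λ ms → ps ≡ vs ++ ms × us ≡ ms ++ qs)
  ++-overlap vs       us []       qs eq = inj₁ (vs , refl , sym eq)
  ++-overlap []       us (p ∷ ps) qs eq = inj₂ (p ∷ ps , refl , eq)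
  ++-overlap (v ∷ vs) us (p ∷ ps) qs eq with ∷-injective eq
  ... | refl , eq′ with ++-overlap vs us ps qs eq′
  ...   | inj₁ (ms , e₁ , e₂) = inj₁ (ms , cong (v ∷_) e₁ , e₂)
  ...   | inj₂ (ms , e₁ , e₂) = inj₂ (ms , cong (v ∷_) e₁ , e₂)

↻-trans : {xs ys zs : List A} → xs ↻ ys → ys ↻ zs → xs ↻ zs
↻-trans (us , vs , refl , e) (ps , qs , e′ , refl)
  with ++-overlap vs us ps qs (trans (sym e) e′)
... | inj₁ (ms , refl , refl) =
  us ++ ps , ms , sym (++-assoc us ps ms) , ++-assoc ms us ps
... | inj₂ (ms , refl , refl) =
  ms , qs ++ vs , ++-assoc ms qs vs , sym (++-assoc qs vs ms)

↻-setoid : Set a → Setoid a a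
↻-setoid A = record
  { Carrier       = List A
  ; _≈_           = _↻_
  ; isEquivalence = record { refl = ↻-refl ; sym = ↻-sym ; trans = ↻-trans }
  }

[1⋯_] : ℕ → List ℕ
[1⋯ n ] = map suc (upTo n)

-- A circular permutation is represented by any of its linear readings;
-- the setoid equality identifies readings that differ by a rotation.
CircularPermutation : ℕ → Setoid 0ℓ 0ℓ
CircularPermutation n =
  On.setoid {B = Σ (List ℕ) (_↭ [1⋯ n ])} (↻-setoid ℕ) proj₁

-- In a sequence of distinct entries, the k-th smallest entry is the one
-- with exactly k entries less than or equal to it.
reduce : List ℕ → List ℕ
reduce xs = map (λ x → length (filter (_≤? x) xs)) xs

-- An occurrence of τ in the circular permutation read as w: a subsequence
-- of some rotation of w.
Occurrence : List ℕ → List ℕ → Set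
Occurrence τ w = ∃₂ λ r s → w ↻ r × s ⊆ r × reduce s ≡ τ

Avoids : List ℕ → List ℕ → Set
Avoids τ w = ¬ Occurrence τ w

Avoiders : ℕ → List ℕ → Setoid 0ℓ 0ℓ
Avoiders n τ =
  On.setoid {B = Σ (Setoid.Carrier (CircularPermutation n)) λ π → Avoids τ (proj₁ π)}
    (CircularPermutation n) proj₁

HasCardinality : Setoid a ℓ → ℕ → Set _
HasCardinality S k = Inverse S (setoid (Fin k))

-- Fibonacci numbers; the negative indices use F (m - 1) = F (m + 1) - F m.
F : ℤ → ℤ
F (+ 0)               = + 0
F (+ 1)               = + 1
F (+ suc (suc m))     = F (+ suc m) ℤ.+ F (+ m)
F -[1+ 0 ]            = + 1
F -[1+ 1 ]            = -[1+ 0 ]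
F -[1+ suc (suc m) ]  = F -[1+ m ] ℤ.- F -[1+ suc m ]

{-# OPTIONS --safe #-}

-- Read from the letter 1, a circular permutation avoids 1324 exactly when this
-- word avoids 213 and 4132 in the ordinary linear sense. Deleting the least
-- letter keeps such a word in the class, and conversely a new least letter can
-- be inserted in exactly three places: at the front, at the end, and
-- immediately before the old least letter (the first and the third coincide
-- when the old least letter is in front). Hence, if f and g count the words of
-- a given length in which the least letter is, respectively is not, in front,
-- then f′ = f + g and g′ = f + 2g for the next length, which is the recurrence
-- of F₂ₙ₋₃ and F₂ₙ₋₂. The circular permutations correspond to the words counted
-- by f.

module Submission where

open import Defs
open import Data.Empty using (⊥)
open import Data.Fin using (Fin)
open import Data.Fin.Properties using (0↔⊥; 1↔⊤; +↔⊎)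
open import Data.Integer using (+_; _*_; _-_)
import Data.Integer as ℤ
open import Data.List using (List; []; _∷_; _++_; [_]; length; filter; applyUpTo)
open import Data.List.Membership.Propositional using (_∈_)
open import Data.List.Membership.Propositional.Properties
  using (∈-∃++; ∈-++⁻; ∈-insert)
open import Data.List.Properties
  using (++-identityʳ; ∷-injective; ∷-injectiveʳ; filter-accept; filter-reject; map-upTo)
open import Data.List.Relation.Binary.Permutation.Propositional
  using (_↭_; ↭-refl; ↭-reflexive; ↭-sym; ↭-trans; prep; ↭⇒↭ₛ)
open import Data.List.Relation.Binary.Permutation.Propositional.Properties
  using (All-resp-↭; ∈-resp-↭; drop-mid; shift; ++-comm; ↭-empty-inv)
import Data.List.Relation.Binary.Permutation.Setoid.Properties as ↭ₛ
open import Data.List.Relation.Binary.Sublist.Propositional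
  using (_⊆_; []; _∷ʳ_; _∷_; ⊆-refl; ⊆-trans; lookup; from∈; to∈; minimum)
open import Data.List.Relation.Binary.Sublist.Propositional.Properties
  using (++⁺; ++⁺ʳ; ++⁺ˡ; ∷ˡ⁻; filter⁺; length-mono-≤)
open import Data.List.Relation.Unary.All as All using (All; []; _∷_)
import Data.List.Relation.Unary.All.Properties as All
open import Data.List.Relation.Unary.Any using (here; there)
open import Data.List.Relation.Unary.AllPairs using ([]; _∷_)
open import Data.List.Relation.Unary.Unique.Propositional using (Unique)
open import Data.Nat as ℕ using (ℕ; zero; suc; _≥_; _<_; _≤_; _≤?_)
open import Data.Nat.Properties
  using (≤-refl; ≤-trans; <-trans; <-irrefl; <-asym; <⇒≤; <⇒≱; <⇒≢; ≰⇒>; <-cmp;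
         +-identityʳ; +-suc; +-comm)
open import Data.Product using (∃; ∃₂; _×_; _,_; proj₁; proj₂)
open import Data.Sum using (_⊎_; inj₁; inj₂)
open import Data.Sum.Function.Propositional using (_⊎-↔_)
open import Data.Sum.Properties using (inj₁-injective; inj₂-injective)
open import Data.Unit using (⊤; tt)
open import Function using (_∘_)
open import Function.Bundles using (Inverse; _↔_)
open import Function.Construct.Composition using (_↔-∘_)
open import Level using (Level)
open import Relation.Binary.Bundles using (Setoid)
open import Relation.Binary.Definitions using (tri<; tri≈; tri>)
open import Relation.Binary.PropositionalEquality
  using (_≡_; _≢_; refl; sym; trans; cong; cong₂; subst; setoid)
open import Relation.Nullary using (¬_; contradiction)

private
  variable
    ℓ ℓ′ ℓ″ : Level
    X : Set ℓ
    lo n : ℕ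

-- Sublists, and lists cut at a marked letter

++-⊆-split : ∀ {s : List X} xs {ys} → s ⊆ xs ++ ys →
  ∃₂ λ s₁ s₂ → s ≡ s₁ ++ s₂ × s₁ ⊆ xs × s₂ ⊆ ys
++-⊆-split [] p = [] , _ , refl , [] , p
++-⊆-split (x ∷ xs) (.x ∷ʳ p) with ++-⊆-split xs p
... | s₁ , s₂ , eq , p₁ , p₂ = s₁ , s₂ , eq , x ∷ʳ p₁ , p₂
++-⊆-split (x ∷ xs) (refl ∷ p) with ++-⊆-split xs p
... | s₁ , s₂ , eq , p₁ , p₂ = x ∷ s₁ , s₂ , cong (x ∷_) eq , refl ∷ p₁ , p₂

⊆-insert⁻ : ∀ {s : List X} u {x v} → s ⊆ u ++ x ∷ v →
  s ⊆ u ++ v ⊎ ∃₂ λ s₁ s₂ → s ≡ s₁ ++ x ∷ s₂ × s₁ ⊆ u × s₂ ⊆ v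
⊆-insert⁻ u p with ++-⊆-split u p
... | s₁ , s₂ , refl , p₁ , (_ ∷ʳ p₂)   = inj₁ (++⁺ p₁ p₂)
... | s₁ , _ , refl , p₁ , (refl ∷ p₂) = inj₂ (s₁ , _ , refl , p₁ , p₂)

⊆-insert : ∀ (u : List X) {x v} → u ++ v ⊆ u ++ x ∷ v
⊆-insert u = ++⁺ (⊆-refl {x = u}) (_ ∷ʳ ⊆-refl)

++-∷-injective : ∀ (u u′ : List X) {x v v′} → All (x ≢_) u → All (x ≢_) u′ →
  u ++ x ∷ v ≡ u′ ++ x ∷ v′ → u ≡ u′ × v ≡ v′
++-∷-injective []      []       _        _        refl = refl , refl
++-∷-injective []      (_ ∷ _)  _        (p ∷ _)  refl = contradiction refl p
++-∷-injective (_ ∷ _) []       (p ∷ _)  _        refl = contradiction refl p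
++-∷-injective (_ ∷ u) (_ ∷ u′) (_ ∷ ps) (_ ∷ qs) eq with ∷-injective eq
... | refl , eq′ with ++-∷-injective u u′ ps qs eq′
...   | refl , eq″ = refl , eq″

-- Words avoiding 213 and 4132

record Good (w : List ℕ) : Set where
  field
    no-213  : ∀ {a b c} → a < b → b < c → ¬ (b ∷ a ∷ c ∷ [] ⊆ w)
    no-4132 : ∀ {a b c d} → a < b → b < c → c < d → ¬ (d ∷ a ∷ c ∷ b ∷ [] ⊆ w)

open Good

Good-resp-⊆ : ∀ {w w′} → w ⊆ w′ → Good w′ → Good w
Good-resp-⊆ p g .no-213  ab bc q    = g .no-213 ab bc (⊆-trans q p)
Good-resp-⊆ p g .no-4132 ab bc cd q = g .no-4132 ab bc cd (⊆-trans q p)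

-- The two hypotheses on u and v rule out the occurrences in which lo plays the
-- letter 1; being least, it can play no other.
Good-insert-min : ∀ u {v} → All (lo <_) u → All (lo <_) v →
  (∀ {b c} → b ∈ u → c ∈ v → ¬ b < c) →
  (∀ {b c d} → d ∈ u → c ∷ b ∷ [] ⊆ v → b < c → ¬ c < d) →
  Good (u ++ v) → Good (u ++ lo ∷ v)
Good-insert-min u lo<u lo<v h₁ h₂ g .no-213 ab bc p with ⊆-insert⁻ u p
... | inj₁ q = g .no-213 ab bc q
... | inj₂ ([] , _ , refl , p₁ , p₂) = <-asym ab (All.lookup lo<v (to∈ p₂))
... | inj₂ (_ ∷ [] , _ , refl , p₁ , p₂) = h₁ (to∈ p₁) (to∈ p₂) bc
... | inj₂ (_ ∷ _ ∷ [] , _ , refl , p₁ , p₂) =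
  <-asym (<-trans ab bc) (All.lookup lo<u (lookup p₁ (there (here refl))))
... | inj₂ (_ ∷ _ ∷ _ ∷ [] , _ , () , p₁ , p₂)
... | inj₂ (_ ∷ _ ∷ _ ∷ _ ∷ _ , _ , () , p₁ , p₂)
Good-insert-min u lo<u lo<v h₁ h₂ g .no-4132 ab bc cd p with ⊆-insert⁻ u p
... | inj₁ q = g .no-4132 ab bc cd q
... | inj₂ ([] , _ , refl , p₁ , p₂) =
  <-asym (<-trans ab (<-trans bc cd)) (All.lookup lo<v (to∈ p₂))
... | inj₂ (_ ∷ [] , _ , refl , p₁ , p₂) = h₂ (to∈ p₁) p₂ bc cd
... | inj₂ (_ ∷ _ ∷ [] , _ , refl , p₁ , p₂) =
  <-asym (<-trans ab bc) (All.lookup lo<u (lookup p₁ (there (here refl))))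
... | inj₂ (_ ∷ _ ∷ _ ∷ [] , _ , refl , p₁ , p₂) =
  <-asym ab (All.lookup lo<u (lookup p₁ (there (here refl))))
... | inj₂ (_ ∷ _ ∷ _ ∷ _ ∷ [] , _ , () , p₁ , p₂)
... | inj₂ (_ ∷ _ ∷ _ ∷ _ ∷ _ ∷ _ , _ , () , p₁ , p₂)

Good-front : ∀ {w} → All (lo <_) w → Good w → Good (lo ∷ w)
Good-front lo<w = Good-insert-min [] [] lo<w (λ ()) (λ ())

Good-end : ∀ {w} → All (lo <_) w → Good w → Good (w ++ lo ∷ [])
Good-end {w = w} lo<w g = Good-insert-min w lo<w [] (λ _ ()) (λ _ ())
  (subst Good (sym (++-identityʳ w)) g)

-- If `lo` plays the letter 1, then `μ`, its right neighbour, can replace it. In such an occurrence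
-- `μ` cannot be a later letter itself, being too small.
Good-before-min : ∀ u {v μ} → lo < μ → All (μ <_) u → All (μ <_) v →
  Good (u ++ μ ∷ v) → Good (u ++ lo ∷ μ ∷ v)
Good-before-min {lo = lo} u {v} {μ} lo<μ μ<u μ<v g =
  Good-insert-min u (All.map (<-trans lo<μ) μ<u) (lo<μ ∷ All.map (<-trans lo<μ) μ<v) h₁ h₂ g
  where
  h₁ : ∀ {b c} → b ∈ u → c ∈ μ ∷ v → ¬ b < c
  h₁ b∈u (here refl) b<c = <-asym b<c (All.lookup μ<u b∈u)
  h₁ b∈u (there c∈v) b<c = g .no-213 (All.lookup μ<u b∈u) b<c (++⁺ (from∈ b∈u) (refl ∷ from∈ c∈v))

  h₂ : ∀ {b c d} → d ∈ u → c ∷ b ∷ [] ⊆ μ ∷ v → b < c → ¬ c < d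
  h₂ d∈u (refl ∷ p) b<c c<d = <-asym b<c (All.lookup μ<v (to∈ p))
  h₂ d∈u (_ ∷ʳ p)   b<c c<d = g .no-4132 (All.lookup μ<v (lookup p (there (here refl)))) b<c c<d
    (++⁺ (from∈ d∈u) (refl ∷ p))

-- Intervals of letters

interval : ℕ → ℕ → List ℕ
interval lo zero    = []
interval lo (suc n) = lo ∷ interval (suc lo) n

applyUpTo≡interval : ∀ (f : ℕ → ℕ) lo n → (∀ i → f i ≡ lo ℕ.+ i) → applyUpTo f n ≡ interval lo n
applyUpTo≡interval f lo zero    f≗ = refl
applyUpTo≡interval f lo (suc n) f≗ = cong₂ _∷_ (trans (f≗ 0) (+-identityʳ lo))
  (applyUpTo≡interval (f ∘ suc) (suc lo) n λ i → trans (f≗ (suc i)) (+-suc lo i))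

[1⋯]≡interval : ∀ n → [1⋯ n ] ≡ interval 1 n
[1⋯]≡interval n = trans (map-upTo suc n) (applyUpTo≡interval suc 1 n λ _ → refl)

interval-> : ∀ lo n → All (lo <_) (interval (suc lo) n)
interval-> lo zero    = []
interval-> lo (suc n) = ≤-refl ∷ All.map (<-trans ≤-refl) (interval-> (suc lo) n)

interval-unique : ∀ lo n → Unique (interval lo n)
interval-unique lo zero    = []
interval-unique lo (suc n) = All.map <⇒≢ (interval-> lo n) ∷ interval-unique (suc lo) n

↭-interval-> : ∀ {w} → w ↭ interval (suc lo) n → All (lo <_) w
↭-interval-> p = All-resp-↭ (↭-sym p) (interval-> _ _)

-- Codes for the words of length n + 1 avoiding 213 and 4132: Code n for all of
-- them, split into Front n (least letter in front) and Rest n.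

mutual
  Front : ℕ → Set
  Front zero    = ⊤
  Front (suc n) = Code n

  Rest : ℕ → Set
  Rest zero    = ⊥
  Rest (suc n) = Code n ⊎ Rest n

  Code : ℕ → Set
  Code n = Front n ⊎ Rest n

-- The names say where the new least letter goes. `before-min` takes only a `Rest` code, so that no
-- word is coded twice.
pattern front c      = inj₁ c
pattern end c        = inj₂ (inj₁ c)
pattern before-min r = inj₂ (inj₂ r)

mutual
  #Front : ℕ → ℕ
  #Front zero    = 1
  #Front (suc n) = #Code n

  #Rest : ℕ → ℕ
  #Rest zero    = 0
  #Rest (suc n) = #Code n ℕ.+ #Rest n

  #Code : ℕ → ℕ
  #Code n = #Front n ℕ.+ #Rest n

mutual
  Fin↔Front : ∀ n → Fin (#Front n) ↔ Front n
  Fin↔Front zero    = 1↔⊤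
  Fin↔Front (suc n) = Fin↔Code n

  Fin↔Rest : ∀ n → Fin (#Rest n) ↔ Rest n
  Fin↔Rest zero    = 0↔⊥
  Fin↔Rest (suc n) = (Fin↔Code n ⊎-↔ Fin↔Rest n) ↔-∘ +↔⊎

  Fin↔Code : ∀ n → Fin (#Code n) ↔ Code n
  Fin↔Code n = (Fin↔Front n ⊎-↔ Fin↔Rest n) ↔-∘ +↔⊎

-- The word of a code on the alphabet {lo, …, lo + n}, cut at its least letter.

mutual
  left : ∀ n → ℕ → Code n → List ℕ
  left n       lo (front c)      = []
  left (suc n) lo (end c)        = word n (suc lo) c
  left (suc n) lo (before-min r) = left n (suc lo) (inj₂ r)

  right : ∀ n → ℕ → Code n → List ℕ
  right zero    lo (front c)      = []
  right (suc n) lo (front c)      = word n (suc lo) c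
  right (suc n) lo (end c)        = []
  -- `suc lo` is the old least letter, now just after the new one.
  right (suc n) lo (before-min r) = suc lo ∷ right n (suc lo) (inj₂ r)

  word : ∀ n → ℕ → Code n → List ℕ
  word n lo c = left n lo c ++ lo ∷ right n lo c

mutual
  left++right↭ : ∀ n lo c → left n lo c ++ right n lo c ↭ interval (suc lo) n
  left++right↭ zero    lo (front c)      = ↭-refl
  left++right↭ (suc n) lo (front c)      = word↭ n (suc lo) c
  left++right↭ (suc n) lo (end c)        =
    ↭-trans (↭-reflexive (++-identityʳ _)) (word↭ n (suc lo) c)
  left++right↭ (suc n) lo (before-min r) = word↭ n (suc lo) (inj₂ r)

  word↭ : ∀ n lo c → word n lo c ↭ interval lo (suc n)
  word↭ n lo c = ↭-trans (shift lo (left n lo c) (right n lo c)) (prep lo (left++right↭ n lo c))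

left-> : ∀ n lo c → All (lo <_) (left n lo c)
left-> n lo c = All.++⁻ˡ (left n lo c) (↭-interval-> (left++right↭ n lo c))

right-> : ∀ n lo c → All (lo <_) (right n lo c)
right-> n lo c = All.++⁻ʳ (left n lo c) (↭-interval-> (left++right↭ n lo c))

word-good : ∀ n lo c → Good (word n lo c)
word-good zero    lo (front c) = Good-front [] λ where
  .no-213 _ _ ()
  .no-4132 _ _ _ ()
word-good (suc n) lo (front c) =
  Good-front (↭-interval-> (word↭ n (suc lo) c)) (word-good n (suc lo) c)
word-good (suc n) lo (end c) =
  Good-end (↭-interval-> (word↭ n (suc lo) c)) (word-good n (suc lo) c)
word-good (suc n) lo (before-min r) = Good-before-min (left n (suc lo) (inj₂ r)) ≤-refl
  (left-> n (suc lo) (inj₂ r)) (right-> n (suc lo) (inj₂ r)) (word-good n (suc lo) (inj₂ r))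

-- Bijectivity of the coding

++-∷-≢[] : ∀ (u : List X) {x v} → u ++ x ∷ v ≢ []
++-∷-≢[] [] ()
++-∷-≢[] (_ ∷ _) ()

left-rest-≢[] : ∀ n lo r → left n lo (inj₂ r) ≢ []
left-rest-≢[] (suc n) lo (inj₁ c) = ++-∷-≢[] (left n (suc lo) c)
left-rest-≢[] (suc n) lo (inj₂ r) = left-rest-≢[] n (suc lo) r

mutual
  -- The cut reveals the last insertion: `front` if the left part is empty, otherwise `end` or
  -- `before-min` according to whether the right part is empty.
  cut-injective : ∀ n lo c c′ → left n lo c ≡ left n lo c′ → right n lo c ≡ right n lo c′ → c ≡ c′
  cut-injective zero    lo (front _) (front _) p q = refl
  cut-injective (suc n) lo (front c) (front c′) p q =
    cong inj₁ (word-injective n (suc lo) c c′ q)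
  cut-injective (suc n) lo (front c) (inj₂ r) p q =
    contradiction (sym p) (left-rest-≢[] (suc n) lo r)
  cut-injective (suc n) lo (inj₂ r) (front c) p q =
    contradiction p (left-rest-≢[] (suc n) lo r)
  cut-injective (suc n) lo (end c) (end c′) p q =
    cong (inj₂ ∘ inj₁) (word-injective n (suc lo) c c′ p)
  cut-injective (suc n) lo (end c) (before-min r) p ()
  cut-injective (suc n) lo (before-min r) (end c) p ()
  cut-injective (suc n) lo (before-min r) (before-min r′) p q = cong (inj₂ ∘ inj₂)
    (inj₂-injective (cut-injective n (suc lo) (inj₂ r) (inj₂ r′) p (∷-injectiveʳ q)))

  word-injective : ∀ n lo c c′ → word n lo c ≡ word n lo c′ → c ≡ c′
  word-injective n lo c c′ eq with ++-∷-injective (left n lo c) (left n lo c′)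
    (All.map <⇒≢ (left-> n lo c)) (All.map <⇒≢ (left-> n lo c′)) eq
  ... | p , q = cut-injective n lo c c′ p q

-- Write `μ` for `suc lo` and suppose `μ < y`. If `μ` is left of `lo`, then `μ lo y` is a 213. If it
-- is right of `y`, then `x lo y` is a 213 when `x < y`, and `x lo y μ` is a 4132 when `y < x`.
least-after-insert : ∀ {x u y v} → (x ∷ u) ++ y ∷ v ↭ interval (suc lo) (suc n) →
  Good ((x ∷ u) ++ lo ∷ y ∷ v) → y ≡ suc lo
least-after-insert {lo = lo} {x = x} {u} {y} {v} p g with <-cmp y (suc lo)
... | tri< y<μ _ _ = contradiction lo<y (<⇒≱ y<μ)
  where
  lo<y : lo < y
  lo<y = All.lookup (↭-interval-> p) (∈-insert (x ∷ u))
... | tri≈ _ y≡μ _ = y≡μ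
... | tri> _ _ μ<y with ∈-++⁻ (x ∷ u) (∈-resp-↭ (↭-sym p) (here refl))
...   | inj₁ μ∈u = contradiction (++⁺ (from∈ μ∈u) (refl ∷ refl ∷ minimum v)) (g .no-213 ≤-refl μ<y)
...   | inj₂ (here μ≡y) = sym μ≡y
...   | inj₂ (there μ∈v) with <-cmp x y
...     | tri< x<y _ _ = contradiction (refl ∷ ++⁺ˡ u (refl ∷ refl ∷ minimum v))
  (g .no-213 (All.lookup (↭-interval-> p) (here refl)) x<y)
...     | tri> _ _ y<x = contradiction (refl ∷ ++⁺ˡ u (refl ∷ refl ∷ from∈ μ∈v))
  (g .no-4132 ≤-refl μ<y y<x)
...     | tri≈ _ x≡y _ with ↭ₛ.Unique-resp-↭ (setoid ℕ) (↭⇒↭ₛ (↭-sym p)) (interval-unique _ _)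
...       | x∉ ∷ _ = contradiction x≡y (All.lookup x∉ (∈-insert u))

mutual
  cut-surjective : ∀ n lo u v → u ++ v ↭ interval (suc lo) n → Good (u ++ lo ∷ v) →
    ∃ λ c → left n lo c ≡ u × right n lo c ≡ v
  cut-surjective zero lo [] v p g = front tt , refl , sym (↭-empty-inv p)
  cut-surjective zero lo (x ∷ u) v p g with ↭-empty-inv p
  ... | ()
  cut-surjective (suc n) lo [] v p g
    with word-surjective n (suc lo) v p (Good-resp-⊆ (_ ∷ʳ ⊆-refl) g)
  ... | c , eq = front c , refl , eq
  cut-surjective (suc n) lo u@(_ ∷ _) [] p g
    with word-surjective n (suc lo) u (↭-trans (↭-reflexive (sym (++-identityʳ u))) p)
           (Good-resp-⊆ (++⁺ʳ _ ⊆-refl) g)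
  ... | c , eq = end c , eq , refl
  cut-surjective (suc n) lo u@(_ ∷ _) (y ∷ v) p g with least-after-insert p g
  ... | refl with cut-surjective n (suc lo) u v (drop-mid u [] p) (Good-resp-⊆ (⊆-insert u) g)
  -- A `Front` code cannot occur: its left part is empty and `u` is not.
  ...   | inj₂ r , l , eq = before-min r , l , cong (suc lo ∷_) eq

  word-surjective : ∀ n lo w → w ↭ interval lo (suc n) → Good w → ∃ λ c → word n lo c ≡ w
  word-surjective n lo w p g with ∈-∃++ (∈-resp-↭ (↭-sym p) (here refl))
  ... | u , v , refl with cut-surjective n lo u v (drop-mid u [] p) g
  ...   | c , refl , refl = c , refl

-- Circular occurrences of 1324

1324-pattern : List ℕ
1324-pattern = 1 ∷ 3 ∷ 2 ∷ 4 ∷ []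

rank : ℕ → List ℕ → ℕ
rank x xs = length (filter (_≤? x) xs)

-- Records one comparison per entry, since `rank` does not compute on variable letters.
data HasRank (x : ℕ) : List ℕ → ℕ → Set where
  []     : HasRank x [] 0
  accept : ∀ {y ys k} → y ≤ x → HasRank x ys k → HasRank x (y ∷ ys) (suc k)
  reject : ∀ {y ys k} → x < y → HasRank x ys k → HasRank x (y ∷ ys) k

HasRank⇒≡ : ∀ {x ys k} → HasRank x ys k → rank x ys ≡ k
HasRank⇒≡ []             = refl
HasRank⇒≡ (accept y≤x r) = trans (cong length (filter-accept (_≤? _) y≤x)) (cong suc (HasRank⇒≡ r))
HasRank⇒≡ (reject x<y r) = trans (cong length (filter-reject (_≤? _) (<⇒≱ x<y))) (HasRank⇒≡ r)

rank-mono-≤ : ∀ {x y} xs → x ≤ y → rank x xs ≤ rank y xs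
rank-mono-≤ xs x≤y = length-mono-≤
  (filter⁺ (_≤? _) (_≤? _) (λ { refl z≤x → ≤-trans z≤x x≤y }) (⊆-refl {x = xs}))

-- Contrapositive of monotonicity; recovers the order of the letters from the reduced form.
rank-cancel-< : ∀ {x y i j} xs → rank x xs ≡ i → rank y xs ≡ j → i < j → x < y
rank-cancel-< xs refl refl i<j = ≰⇒> λ y≤x → <⇒≱ i<j (rank-mono-≤ xs y≤x)

reduce-1324⁺ : ∀ {a b c d} → a < b → b < c → c < d → reduce (a ∷ c ∷ b ∷ d ∷ []) ≡ 1324-pattern
reduce-1324⁺ a<b b<c c<d =
  cong₂ _∷_ (HasRank⇒≡ (accept ≤-refl (reject a<c (reject a<b (reject a<d [])))))
  (cong₂ _∷_ (HasRank⇒≡ (accept (<⇒≤ a<c) (accept ≤-refl (accept (<⇒≤ b<c) (reject c<d [])))))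
  (cong₂ _∷_ (HasRank⇒≡ (accept (<⇒≤ a<b) (reject b<c (accept ≤-refl (reject b<d [])))))
  (cong₂ _∷_ (HasRank⇒≡ (accept (<⇒≤ a<d) (accept (<⇒≤ c<d) (accept (<⇒≤ b<d) (accept ≤-refl [])))))
  refl)))
  where
  a<c = <-trans a<b b<c
  b<d = <-trans b<c c<d
  a<d = <-trans a<b b<d

reduce-1324⁻ : ∀ s → reduce s ≡ 1324-pattern →
  ∃₂ λ a b → ∃₂ λ c d → s ≡ a ∷ c ∷ b ∷ d ∷ [] × a < b × b < c × c < d
reduce-1324⁻ s@(a ∷ c ∷ b ∷ d ∷ []) eq
  with ra , eq₁ ← ∷-injective eq
  with rc , eq₂ ← ∷-injective eq₁
  with rb , eq₃ ← ∷-injective eq₂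
  with rd , _   ← ∷-injective eq₃
  = a , b , c , d , refl
  -- `a`, `b`, `c`, `d` have ranks 1, 2, 3, 4, so each comparison is between consecutive numbers.
  , rank-cancel-< s ra rb ≤-refl , rank-cancel-< s rb rc ≤-refl , rank-cancel-< s rc rd ≤-refl

Avoids-resp-↻ : ∀ {τ w w′} → w ↻ w′ → Avoids τ w → Avoids τ w′
Avoids-resp-↻ w↻w′ av (r , s , w′↻r , occ) = av (r , s , ↻-trans w↻w′ w′↻r , occ)

-- The rotation cuts 1324 into two pieces, which appear in `w` in swapped order. Uncut, or cut after
-- 1, it leaves 324, a 213; cut after 13, it gives 2413, which contains 213; cut after 132, it gives
-- 4132.
Good⇒Avoids : ∀ {w} → Good w → Avoids 1324-pattern w
Good⇒Avoids g (_ , s , (us , vs , refl , refl) , s⊆ , red) with reduce-1324⁻ s red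
... | a , b , c , d , refl , ab , bc , cd with ++-⊆-split vs s⊆
... | [] , _ , refl , p₁ , p₂ = g .no-213 bc cd (++⁺ʳ vs (∷ˡ⁻ p₂))
... | _ ∷ [] , _ , refl , p₁ , p₂ = g .no-213 bc cd (++⁺ʳ vs p₂)
... | _ ∷ _ ∷ [] , _ , refl , p₁ , p₂ = g .no-213 ab bc (++⁺ (from∈ (to∈ p₂)) p₁)
... | _ ∷ _ ∷ _ ∷ [] , _ , refl , p₁ , p₂ = g .no-4132 ab bc cd (++⁺ p₂ p₁)
... | _ ∷ _ ∷ _ ∷ _ ∷ [] , _ , refl , p₁ , p₂ = g .no-213 bc cd (++⁺ˡ us (∷ˡ⁻ p₁))
... | _ ∷ _ ∷ _ ∷ _ ∷ _ ∷ _ , _ , () , p₁ , p₂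

∷-⊆-split : ∀ {x : X} {s w} → x ∷ s ⊆ w → ∃₂ λ us vs → w ≡ us ++ vs × [ x ] ⊆ us × s ⊆ vs
∷-⊆-split (refl ∷ p) = [ _ ] , _ , refl , ⊆-refl , p
∷-⊆-split (y ∷ʳ p) with ∷-⊆-split p
... | us , vs , eq , q , r = y ∷ us , vs , cong (y ∷_) eq , y ∷ʳ q , r

-- Putting `lo` before a 213 makes a 1324; rotating the 4 of a 4132 to the end makes one too.
Avoids⇒Good : ∀ {w} → All (lo <_) w → Avoids 1324-pattern (lo ∷ w) → Good (lo ∷ w)
Avoids⇒Good lo<w av .no-213 ab bc (refl ∷ p) = <-asym ab (All.lookup lo<w (to∈ p))
Avoids⇒Good lo<w av .no-213 ab bc (_ ∷ʳ p) = av
  (_ , _ , ↻-refl , refl ∷ p , reduce-1324⁺ (All.lookup lo<w (lookup p (there (here refl)))) ab bc)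
Avoids⇒Good lo<w av .no-4132 ab bc cd p with ∷-⊆-split p
... | us , vs , eq , q , r = av (vs ++ us , _ , (us , vs , eq , refl) , ++⁺ r q , reduce-1324⁺ ab bc cd)

-- Counting circular permutations

enumeration⇒HasCardinality : ∀ {C : Set ℓ} {k} (S : Setoid ℓ′ ℓ″) → Fin k ↔ C →
  let open Setoid S in
  (f : C → Carrier) → (∀ c c′ → f c ≈ f c′ → c ≡ c′) → (∀ x → ∃ λ c → f c ≈ x) →
  HasCardinality S k
enumeration⇒HasCardinality S Fin↔C f inj surj = record
  { to        = λ x → E.from (proj₁ (surj x))
  ; from      = λ i → f (E.to i)
  ; to-cong   = λ {x} {y} x≈y → cong E.from
      (inj _ _ (S.trans (proj₂ (surj x)) (S.trans x≈y (S.sym (proj₂ (surj y))))))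
  ; from-cong = λ { refl → S.refl }
  ; inverse   = (λ {i} {x} x≈fi → E.inverseʳ (inj _ _ (S.trans (proj₂ (surj x)) x≈fi)))
              , (λ { {x} refl → S.trans (S.reflexive (cong f (E.inverseˡ refl))) (proj₂ (surj x)) })
  }
  where
  module S = Setoid S
  module E = Inverse Fin↔C

-- A nontrivial rotation would start with a letter of `w`, and `x` is not among these.
min-first-↻⇒≡ : ∀ {x w w′} → All (x <_) w → x ∷ w ↻ x ∷ w′ → w ≡ w′
min-first-↻⇒≡ x<w ([]     , vs     , refl , eq) = sym (trans (∷-injectiveʳ eq) (++-identityʳ _))
min-first-↻⇒≡ x<w (_ ∷ us , []     , refl , eq) = trans (++-identityʳ us) (sym (∷-injectiveʳ eq))
min-first-↻⇒≡ x<w (_ ∷ us , v ∷ vs , refl , refl) =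
  contradiction (All.lookup x<w (∈-insert us)) (<-irrefl refl)

-- Both parities advance together: each step of the insertion recurrence is two Fibonacci steps.
F-#Code : ∀ n → F (+ (n ℕ.+ n)) ≡ + #Rest n × F (+ suc (n ℕ.+ n)) ≡ + #Code n
F-#Code zero    = refl , refl
F-#Code (suc n) with F-#Code n
... | r , c rewrite +-suc n n =
  F-2n+2 , trans (cong₂ ℤ._+_ F-2n+2 c) (cong +_ (+-comm (#Rest (suc n)) (#Code n)))
  where
  F-2n+2 = cong₂ ℤ._+_ c r

2n-3 : ∀ n → + 2 * + suc (suc n) - + 3 ≡ + suc (n ℕ.+ n)
2n-3 n = cong (λ k → + suc (suc k) - + 3)
  (trans (+-suc n _) (cong suc (trans (+-suc n _) (cong (λ k → suc (n ℕ.+ k)) (+-identityʳ n)))))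

module _ (m : ℕ) where

  reading : Front m → Setoid.Carrier (Avoiders (suc m) 1324-pattern)
  reading c = (word m 1 (front c) , perm) , Good⇒Avoids (word-good m 1 (front c))
    where
    perm = ↭-trans (word↭ m 1 (front c)) (↭-reflexive (sym ([1⋯]≡interval (suc m))))

  reading-injective : ∀ c c′ → word m 1 (front c) ↻ word m 1 (front c′) → c ≡ c′
  reading-injective c c′ eq =
    inj₁-injective (cut-injective m 1 (front c) (front c′) refl
      (min-first-↻⇒≡ (right-> m 1 (front c)) eq))

  -- Rotating the letter 1 to the front gives a good word with empty left part, which forces a
  -- `Front` code.
  reading-surjective : ∀ (π : Setoid.Carrier (Avoiders (suc m) 1324-pattern)) →
    ∃ λ c → word m 1 (front c) ↻ proj₁ (proj₁ π)
  reading-surjective ((π , p) , av) with ∈-∃++ (∈-resp-↭ (↭-sym p) (here refl))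
  ... | u , v , refl = reading-v++u
    where
    v++u↭ : v ++ u ↭ interval 2 m
    v++u↭ = ↭-trans (++-comm v u)
      (drop-mid u [] (↭-trans p (↭-reflexive ([1⋯]≡interval (suc m)))))

    rotation : 1 ∷ v ++ u ↻ u ++ 1 ∷ v
    rotation = 1 ∷ v , u , refl , refl

    reading-v++u : ∃ λ c → word m 1 (front c) ↻ u ++ 1 ∷ v
    reading-v++u with cut-surjective m 1 [] (v ++ u) v++u↭
      (Avoids⇒Good (↭-interval-> v++u↭) (Avoids-resp-↻ (↻-sym rotation) av))
    ... | front c , _ , refl′ = c , subst (λ w → 1 ∷ w ↻ u ++ 1 ∷ v) (sym refl′) rotation
    ... | inj₂ r , l , _ = contradiction l (left-rest-≢[] m 1 r)

theorem1 : (n : ℕ) → n ≥ 1 →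
    ∃ λ k → HasCardinality (Avoiders n (1 ∷ 3 ∷ 2 ∷ 4 ∷ [])) k × + k ≡ F (+ 2 * + n - + 3)
theorem1 (suc m) _ = #Front m
  , enumeration⇒HasCardinality (Avoiders (suc m) _) (Fin↔Front m)
      (reading m) (reading-injective m) (reading-surjective m)
  , count m
  where
  count : ∀ m → + #Front m ≡ F (+ 2 * + suc m - + 3)
  -- Here the index is -1, where `F` is 1.
  count zero    = refl
  -- `#Front (suc m)` is `#Code m` by definition, and the index is the odd number 2m + 1.
  count (suc m) = sym (trans (cong F (2n-3 m)) (proj₂ (F-#Code m)))
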